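{- On the set of the $512$ mesh patterns $(12,R)$, $R\subseteq\{0,1,2\}\times\{0,1,2\}$, the equivalence relation of coincidence under $321$ (that is, $p_1\sim p_2$ if and only if $\mathrm{Av}(\{321,p_1\})=\mathrm{Av}(\{321,p_2\})$) has exactly $213$ equivalence classes.
   Context: Write $[n]=\{1,\dots,n\}$. A permutation of length $n$ is a bijection of $[n]$, written in one-line notation; $G(\pi)=\{(i,\pi(i)) : i\in[n]\}$ is its plot. A mesh pattern of length $k$ is a pair $p=(\tau,R)$ with $\tau$ a permutation of length $k$ and $R\subseteq\{0,\dots,k\}^2$. An occurrence of $p$ in a permutation $\pi$ of length $n$ is a subset $\omega\subseteq G(\pi)$ for which there are order-preserving injections $\alpha,\beta:[k]\to[n]$ such that (i) $\omega=\{(\alpha(i),\beta(j)):(i,j)\in G(\tau)\}$, and (ii) with $\alpha(0)=\beta(0)=0$, $\alpha(k+1)=\beta(k+1)=n+1$ and $R_{ij}=[\alpha(i)+1,\alpha(i+1)-1]\times[\beta(j)+1,\beta(j+1)-1]$, one has $R_{ij}\cap G(\pi)=\emptyset$ for every $(i,j)\in R$. A permutation avoids $p$ if it has no occurrence of $p$. A classical pattern $\pi$ is identified with the mesh pattern $(\pi,\emptyset)$. $\mathrm{Av}(S)$ is the set of all permutations (of all lengths, including the empty one) avoiding every pattern in $S$. -}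

module Defs where

open import Data.Fin.Base using (Fin; suc; inject₁; toℕ; fromℕ; _≤_)
open import Data.Fin.Permutation using (Permutation′; _⟨$⟩ʳ_; id; reverse)
open import Data.Fin.Subset using (Subset; ⊥) renaming (_∈_ to _∈ˢ_)
open import Data.Nat.Base as ℕ using (ℕ; zero; suc)
open import Data.Product.Base using (∃; ∃₂; _×_; _,_)
open import Data.Vec.Base using (Vec; lookup; replicate)
open import Data.Vec.Functional using (Vector; _∷_; insertAt)
open import Function.Base using (_∘_)
open import Function.Definitions using (Injective)
open import Level using (0ℓ) renaming (suc to lsuc)
open import Relation.Binary.Bundles using (Setoid)
open import Relation.Binary.Definitions using (Monotonic₁)
open import Relation.Binary.PropositionalEquality.Core using (_≡_)
import Relation.Binary.Construct.On as On
open import Relation.Nullary.Negation.Core using (¬_)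
open import Relation.Unary using (Pred; _∈_; _⊆_; _≐_; _∪_; _∩_; ｛_｝; Empty)
open import Relation.Unary.Relation.Binary.Equality using (≐-setoid)

-- Positions and values of a permutation of length n live in Fin n, so x : Fin n
-- stands for the element suc (toℕ x) of [n].

Perm : Set
Perm = ∃ Permutation′

G : ∀ {n} → Permutation′ n → Pred (Fin n × Fin n) 0ℓ
G π (x , y) = π ⟨$⟩ʳ x ≡ y

-- A subset R of {0,…,k}²: (i , j) belongs to R iff j belongs to the subset at
-- index i.
Shading : ℕ → Set
Shading k = Vec (Subset (suc k)) (suc k)

cells : ∀ {k} → Shading k → Pred (Fin (suc k) × Fin (suc k)) 0ℓ
cells R (i , j) = j ∈ˢ lookup R i

record MeshPattern : Set where
  constructor mesh
  field
    {size}  : ℕ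
    τ       : Permutation′ size
    shading : Shading size

classical : ∀ {k} → Permutation′ k → MeshPattern
classical {k} τ = mesh τ (replicate (suc k) ⊥)

OrderPreservingInjection : ∀ {k n} → (Fin k → Fin n) → Set
OrderPreservingInjection α = Monotonic₁ _≤_ _≤_ α × Injective _≡_ _≡_ α

-- The 1-based values α(0) = 0, α(1), …, α(k), α(k+1) = n+1.
extend : ∀ {k n} → (Fin k → Fin n) → Vector ℕ (suc (suc k))
extend {k} {n} α = 0 ∷ insertAt (suc ∘ toℕ ∘ α) (fromℕ k) (suc n)

-- The i-th interval [α(i)+1 , α(i+1)-1], for i in {0,…,k}.
Between : ∀ {k n} → (Fin k → Fin n) → Fin (suc k) → Pred (Fin n) 0ℓ
Between α i x = extend α (inject₁ i) ℕ.< suc (toℕ x) × suc (toℕ x) ℕ.< extend α (suc i)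

Region : ∀ {k n} → (α β : Fin k → Fin n) → Fin (suc k) × Fin (suc k) →
         Pred (Fin n × Fin n) 0ℓ
Region α β (i , j) (x , y) = x ∈ Between α i × y ∈ Between β j

Image : ∀ {k n} → (α β : Fin k → Fin n) → Pred (Fin k × Fin k) 0ℓ →
        Pred (Fin n × Fin n) 0ℓ
Image α β P (x , y) = ∃₂ λ i j → (i , j) ∈ P × x ≡ α i × y ≡ β j

IsOccurrence : ∀ {n} → MeshPattern → Permutation′ n → Pred (Fin n × Fin n) 0ℓ → Set
IsOccurrence (mesh τ R) π ω =
  ω ⊆ G π ×
  ∃₂ λ α β →
    OrderPreservingInjection α ×
    OrderPreservingInjection β ×
    ω ≐ Image α β (G τ) ×
    (∀ {c} → c ∈ cells R → Empty (Region α β c ∩ G π))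

Avoids : Perm → MeshPattern → Set (lsuc 0ℓ)
Avoids (_ , π) p = ¬ ∃ (IsOccurrence p π)

Av : Pred MeshPattern 0ℓ → Pred Perm (lsuc 0ℓ)
Av S σ = ∀ {p} → p ∈ S → Avoids σ p

p321 : Permutation′ 3
p321 = reverse

p12 : Permutation′ 2
p12 = id

-- The mesh patterns (12 , R), each represented by its R, under
-- Av {321 , (12 , R₁)} = Av {321 , (12 , R₂)}.
coincidenceUnder321 : Setoid 0ℓ (lsuc 0ℓ)
coincidenceUnder321 =
  On.setoid (≐-setoid Perm (lsuc 0ℓ)) λ (R : Shading 2) →
    Av (｛ classical p321 ｝ ∪ ｛ mesh p12 R ｝)

{-# OPTIONS --safe #-}

-- Shadings that do not coincide are separated by a permutation of length at most 5, so
-- the work lies in proving that the others do coincide. To show that a 321-avoiding π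
-- avoiding (12 , S) also avoids (12 , R), take an occurrence of (12 , R) whose first
-- point is as far right as possible. It suffices to find, among the points of π known
-- so far, two that form an occurrence of (12 , S), or one of (12 , R) whose first point
-- is further right. The known points cut the plot into cells. If a cell could contain
-- points spoiling the desired occurrence, suppose that it does, and add an extremal one
-- of them to the known points; cells in which a point would complete a 321 are empty.
-- Three added points are always enough.
module Submission where

open import Defs
open import Data.Bool.Base using (Bool; true; false; if_then_else_)
import Data.Bool.Properties as Bool
open import Data.Empty using (⊥)
open import Data.Fin.Base as Fin using (Fin; zero; suc; toℕ)
import Data.Fin.Induction as Fin
open import Data.Fin.Patterns using (0F; 1F; 2F)
open import Data.Fin.Permutation as Perm using (Permutation′; _⟨$⟩ʳ_)
import Data.Fin.Properties as Fin
open import Data.Fin.Subset using () renaming (_∈_ to _∈ˢ_)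
open import Data.Fin.Subset.Properties using (∉⊥) renaming (_∈?_ to _∈ˢ?_)
open import Data.List.Base
  using (List; []; _∷_; map; filter; concatMap; cartesianProduct; allFin; length)
import Data.List.Membership.DecPropositional as DecMembership
open import Data.List.Membership.Propositional using (_∉_; lose; find) renaming (_∈_ to _∈ˡ_)
open import Data.List.Membership.Propositional.Properties
  using (∈-map⁺; ∈-map⁻; ∈-filter⁺; ∈-concatMap⁺; ∈-cartesianProduct⁺; ∈-allFin)
open import Data.List.NonEmpty.Base as List⁺ using (List⁺; _∷_; [_]; head; toList)
open import Data.List.Properties using (≡-dec; map-∘; map-cong-local)
open import Data.List.Relation.Unary.All as All using (All)
open import Data.List.Relation.Unary.Any using (Any; here; there; any?)
import Data.List.Relation.Unary.Any.Properties as Any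
open import Data.Nat.Base using (ℕ; zero; suc; _+_; _*_; _^_; _∸_; _⊓_; _≤_; _<_; z≤n; s≤s)
open import Data.Nat.DivMod using (_/_; _%_; _mod_)
open import Data.Nat.Properties
open import Data.Product.Base using (∃; ∃₂; _×_; _,_; proj₁; proj₂; uncurry; <_,_>)
open import Data.Sum.Base using (_⊎_; inj₁; inj₂; [_,_]′)
open import Data.Vec.Base as Vec using (Vec; []; _∷_; lookup; replicate; tabulate)
open import Data.Vec.Functional using () renaming ([] to []ᶠ; _∷_ to _∷ᶠ_)
open import Data.Vec.Properties using (lookup-replicate)
open import Function.Base using (id; _∘_; _on_)
open import Function.Bundles
  using (Bijection; _⇔_; mk⇔; module Equivalence; module Injection)
open import Function.Properties.Inverse using (↔⇒↣)
open import Induction.WellFounded using (WellFounded; Acc; acc)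
open import Level using (0ℓ) renaming (suc to lsuc)
import Relation.Binary.Construct.On as On
open import Relation.Binary.Core using (Rel)
open import Relation.Binary.Definitions
  using (DecidableEquality; tri<; tri≈; tri>) renaming (Decidable to Decidable₂)
open import Relation.Binary.PropositionalEquality
  using (_≡_; _≢_; refl; sym; trans; cong; cong₂; subst; subst₂; ≢-sym; module ≡-Reasoning)
open import Relation.Binary.PropositionalEquality.Properties using (setoid)
open import Relation.Nullary.Decidable
  using ( Dec; yes; no; does; map′; toWitness; dec-true; dec-false; does-⇔
        ; ¬?; _×-dec_; _⊎-dec_; _→-dec_)
open import Relation.Nullary.Negation using (¬_; contradiction)
open import Relation.Unary
  using (Pred; Decidable; Empty; _∈_; _⊆_; _≐_; _∩_; _∪_; ｛_｝) renaming (_∉_ to _∉ᵖ_)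

-- Ranks relative to a list of known elements

-- δ z x is 0, 1 or 2 according to whether x < z, x ≡ z or x > z.
δ : ℕ → ℕ → ℕ
δ z x = 2 ⊓ (suc x ∸ z)

δ-< : ∀ {z x} → x < z → δ z x ≡ 0
δ-< x<z = cong (2 ⊓_) (m≤n⇒m∸n≡0 x<z)

δ-refl : ∀ z → δ z z ≡ 1
δ-refl z = cong (2 ⊓_) (m+n∸n≡m 1 z)

δ-> : ∀ {z x} → z < x → δ z x ≡ 2
δ-> z<x = m≤n⇒m⊓n≡m (m+n≤o⇒m≤o∸n 2 (s≤s z<x))

δ-monoʳ : ∀ z {x y} → x ≤ y → δ z x ≤ δ z y
δ-monoʳ z x≤y = ⊓-monoʳ-≤ 2 (∸-monoˡ-≤ z (s≤s x≤y))

δ-≥ : ∀ {z x} → z ≤ x → 1 ≤ δ z x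
δ-≥ {z} {x} z≤x = subst (_≤ δ z x) (δ-refl z) (δ-monoʳ z z≤x)

δ-≤ : ∀ {z x} → x ≤ z → δ z x ≤ 1
δ-≤ {z} {x} x≤z = subst (δ z x ≤_) (δ-refl z) (δ-monoʳ z x≤z)

-- The possible values of δ z x + s for x ≢ z, where c and s are the ranks of z and x.
choices : ℕ → ℕ → List ℕ
choices c s = if does (c ≟ s) then s ∷ 2 + s ∷ [] else (δ c s + s) ∷ []

-- The values at `s ≡ p` and `s ≡ q` are fillers: zones are read as open intervals only for other
-- coordinates.
zone : ℕ → ℕ → ℕ → Fin 3
zone p q s = if does (s <? p) then 0F else if does (s <? q) then 1F else 2F

zone-cong : ∀ {p q s p′ q′ s′} → (s < p ⇔ s′ < p′) → (s < q ⇔ s′ < q′) →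
            zone p q s ≡ zone p′ q′ s′
zone-cong {p} {q} {s} {p′} {q′} {s′} eq₁ eq₂ =
  cong₂ (λ l m → if l then 0F else if m then 1F else 2F)
        (does-⇔ eq₁ (s <? p) (s′ <? p′)) (does-⇔ eq₂ (s <? q) (s′ <? q′))

zone-0 : ∀ {p q s} → s < p → zone p q s ≡ 0F
zone-0 {p} {q} {s} s<p rewrite dec-true (s <? p) s<p = refl

zone-1 : ∀ {p q s} → p < s → s < q → zone p q s ≡ 1F
zone-1 {p} {q} {s} p<s s<q
  rewrite dec-false (s <? p) (<-asym p<s) | dec-true (s <? q) s<q = refl

zone-2 : ∀ {p q s} → p < q → q < s → zone p q s ≡ 2F
zone-2 {p} {q} {s} p<q q<s
  rewrite dec-false (s <? p) (<-asym (<-trans p<q q<s)) | dec-false (s <? q) (<-asym q<s) = refl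

data ZoneView (p q s : ℕ) : Set where
  below   : s < p → ZoneView p q s
  between : p < s → s < q → ZoneView p q s
  above   : q < s → ZoneView p q s

zoneView : ∀ {p q s} → s ≢ p → s ≢ q → ZoneView p q s
zoneView {p} {q} {s} s≢p s≢q with <-cmp s p | <-cmp s q
... | tri< s<p _ _ | _            = below s<p
... | tri≈ _ s≡p _ | _            = contradiction s≡p s≢p
... | tri> _ _ p<s | tri< s<q _ _ = between p<s s<q
... | tri> _ _ p<s | tri≈ _ s≡q _ = contradiction s≡q s≢q
... | tri> _ _ p<s | tri> _ _ q<s = above q<s

module _ {A : Set} (κ : A → ℕ) where

  -- Twice the number of known elements below x, plus the number of those level with x.
  rank : List A → A → ℕ
  rank []       x = 0
  rank (z ∷ zs) x = δ (κ z) (κ x) + rank zs x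

  rank-mono : ∀ zs {x y} → κ x ≤ κ y → rank zs x ≤ rank zs y
  rank-mono []       x≤y = z≤n
  rank-mono (z ∷ zs) x≤y = +-mono-≤ (δ-monoʳ (κ z) x≤y) (rank-mono zs x≤y)

  rank-reflects-< : ∀ zs {x y} → rank zs x < rank zs y → κ x < κ y
  rank-reflects-< zs lt = ≰⇒> λ y≤x → <⇒≱ lt (rank-mono zs y≤x)

  -- Strictness comes from the summand of `z` itself, which is 0 at `x` and 1 at `z`; the other
  -- summands are monotone.
  rank-below : ∀ {zs x z} → z ∈ˡ zs → κ x < κ z → rank zs x < rank zs z
  rank-below {z ∷ zs} (here refl) x<z =
    +-mono-<-≤ (subst₂ _<_ (sym (δ-< x<z)) (sym (δ-refl (κ z))) (s≤s z≤n))
               (rank-mono zs (<⇒≤ x<z))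
  rank-below {w ∷ zs} (there z∈)  x<z =
    +-mono-≤-< (δ-monoʳ (κ w) (<⇒≤ x<z)) (rank-below z∈ x<z)

  rank-above : ∀ {zs x z} → z ∈ˡ zs → κ z < κ x → rank zs z < rank zs x
  rank-above {z ∷ zs} (here refl) z<x =
    +-mono-<-≤ (subst₂ _<_ (sym (δ-refl (κ z))) (sym (δ-> z<x)) (s≤s (s≤s z≤n)))
               (rank-mono zs (<⇒≤ z<x))
  rank-above {w ∷ zs} (there z∈)  z<x =
    +-mono-≤-< (δ-monoʳ (κ w) (<⇒≤ z<x)) (rank-above z∈ z<x)

  rank-injective : ∀ {zs x z} → z ∈ˡ zs → rank zs x ≡ rank zs z → κ x ≡ κ z
  rank-injective {x = x} {z} z∈ eq with <-cmp (κ x) (κ z)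
  ... | tri< x<z _ _ = contradiction eq (<⇒≢ (rank-below z∈ x<z))
  ... | tri≈ _ x≡z _ = x≡z
  ... | tri> _ _ z<x = contradiction (sym eq) (<⇒≢ (rank-above z∈ z<x))

  -- A zone depends only on comparisons with `a` and `b`, and ranks preserve and reflect comparisons
  -- with known elements. So the search can read off cells from ranks.
  zone-rank : ∀ {zs a b} x → a ∈ˡ zs → b ∈ˡ zs →
              zone (rank zs a) (rank zs b) (rank zs x) ≡ zone (κ a) (κ b) (κ x)
  zone-rank {zs} x a∈ b∈ =
    zone-cong (mk⇔ (rank-reflects-< zs) (rank-below a∈))
              (mk⇔ (rank-reflects-< zs) (rank-below b∈))

  δ-rank-≢ : ∀ zs {x} z → rank zs x ≢ rank zs z →
             δ (rank zs z) (rank zs x) ≡ δ (κ z) (κ x)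
  δ-rank-≢ zs {x} z ≢ with <-cmp (rank zs x) (rank zs z)
  ... | tri< lt _ _ = trans (δ-< lt) (sym (δ-< (rank-reflects-< zs lt)))
  ... | tri≈ _ eq _ = contradiction eq ≢
  ... | tri> _ _ gt = trans (δ-> gt) (sym (δ-> (rank-reflects-< zs gt)))

  -- Unequal ranks order elements correctly, and a rank equal to that of a known element means being
  -- level with it. Hence adding `z` changes the ranks of known elements by an amount that can be
  -- computed from ranks alone.
  δ-rank-∈ : ∀ zs {x} z → x ∈ˡ z ∷ zs → δ (rank zs z) (rank zs x) ≡ δ (κ z) (κ x)
  δ-rank-∈ zs z (here refl) = trans (δ-refl (rank zs z)) (sym (δ-refl (κ z)))
  δ-rank-∈ zs {x} z (there x∈) with rank zs x ≟ rank zs z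
  ... | no  ≢  = δ-rank-≢ zs z ≢
  ... | yes eq = begin
    δ (rank zs z) (rank zs x)  ≡⟨ cong (δ (rank zs z)) eq ⟩
    δ (rank zs z) (rank zs z)  ≡⟨ δ-refl (rank zs z) ⟩
    1                          ≡⟨ δ-refl (κ z) ⟨
    δ (κ z) (κ z)              ≡⟨ cong (δ (κ z)) (rank-injective x∈ (sym eq)) ⟩
    δ (κ z) (κ x)              ∎
    where open ≡-Reasoning

  rank∈choices : ∀ zs {x} z → κ x ≢ κ z →
                 rank (z ∷ zs) x ∈ˡ choices (rank zs z) (rank zs x)
  rank∈choices zs {x} z x≢z with rank zs z ≟ rank zs x
  ... | no  ≢ rewrite dec-false (rank zs z ≟ rank zs x) ≢ =
    here (cong (_+ rank zs x) (sym (δ-rank-≢ zs z (≢ ∘ sym))))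
  ... | yes eq rewrite dec-true (rank zs z ≟ rank zs x) eq with <-cmp (κ x) (κ z)
  ...   | tri< lt _ _ = here (cong (_+ rank zs x) (δ-< lt))
  ...   | tri≈ _ x≡z _ = contradiction x≡z x≢z
  ...   | tri> _ _ gt = there (here (cong (_+ rank zs x) (δ-> gt)))

  module _ {a b : A} (a<b : κ a < κ b) where

    rank-first : rank (a ∷ b ∷ []) a ≡ 1
    rank-first = cong₂ (λ m n → m + (n + 0)) (δ-refl (κ a)) (δ-< a<b)

    rank-second : rank (a ∷ b ∷ []) b ≡ 3
    rank-second = cong₂ (λ m n → m + (n + 0)) (δ-> a<b) (δ-refl (κ b))

    -- Each known element contributes 0 or 2, so all other elements have rank 0, 2 or 4, around the
    -- known ranks 1 and 3. These are the coordinates of the initial state.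
    rank-zone : ∀ {x} → κ x ≢ κ a → κ x ≢ κ b →
                rank (a ∷ b ∷ []) x ≡ 2 * toℕ (zone (κ a) (κ b) (κ x))
    rank-zone x≢a x≢b with zoneView x≢a x≢b
    ... | below x<a rewrite zone-0 {q = κ b} x<a =
      cong₂ (λ m n → m + (n + 0)) (δ-< x<a) (δ-< (<-trans x<a a<b))
    ... | between a<x x<b rewrite zone-1 a<x x<b =
      cong₂ (λ m n → m + (n + 0)) (δ-> a<x) (δ-< x<b)
    ... | above b<x rewrite zone-2 a<b b<x =
      cong₂ (λ m n → m + (n + 0)) (δ-> (<-trans a<b b<x)) (δ-> b<x)

-- The search

-- The coordinates of a point, either its own or its ranks relative to the known points.
Place : Set
Place = ℕ × ℕ

_≟ᵖ_ : DecidableEquality Place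
(a , b) ≟ᵖ (c , d) = map′ (uncurry (cong₂ _,_)) < cong proj₁ , cong proj₂ > (a ≟ c ×-dec b ≟ d)

open DecMembership _≟ᵖ_ using () renaming (_∈?_ to _∈ˡ?_)

Ascends Descends : Rel Place 0ℓ
Ascends  (s₁ , s₂) (t₁ , t₂) = s₁ < t₁ × s₂ < t₂
Descends (s₁ , s₂) (t₁ , t₂) = s₁ < t₁ × t₂ < s₂

ascends? : Decidable₂ Ascends
ascends? (s₁ , s₂) (t₁ , t₂) = s₁ <? t₁ ×-dec s₂ <? t₂

descends? : Decidable₂ Descends
descends? (s₁ , s₂) (t₁ , t₂) = s₁ <? t₁ ×-dec t₂ <? s₂

Completes321 : List Place → Pred Place 0ℓ
Completes321 ps s = Any (λ p → Any (λ q →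
  (Descends s p × Descends p q) ⊎ (Descends p s × Descends s q) ⊎
  (Descends p q × Descends q s)) ps) ps

completes321? : ∀ ps → Decidable (Completes321 ps)
completes321? ps s = any? (λ p → any? (λ q →
  (descends? s p ×-dec descends? p q) ⊎-dec (descends? p s ×-dec descends? s q) ⊎-dec
  (descends? p q ×-dec descends? q s)) ps) ps

unshaded? : ∀ (R : Shading 2) c → Dec (c ∉ᵖ cells R)
unshaded? R (i , j) = ¬? (j ∈ˢ? lookup R i)

Clear : Shading 2 → (p q : Place) → Pred Place 0ℓ
Clear P (p₁ , p₂) (q₁ , q₂) (s₁ , s₂) = (zone p₁ q₁ s₁ , zone p₂ q₂ s₂) ∉ᵖ cells P

clear? : ∀ P p q → Decidable (Clear P p q)
clear? P (p₁ , p₂) (q₁ , q₂) (s₁ , s₂) = unshaded? P (zone p₁ q₁ s₁ , zone p₂ q₂ s₂)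

Harmless : Shading 2 → (p q : Place) → Pred Place 0ℓ
Harmless P p q s = s ≡ p ⊎ s ≡ q ⊎ Clear P p q s

harmless? : ∀ P p q → Decidable (Harmless P p q)
harmless? P p q s = s ≟ᵖ p ⊎-dec s ≟ᵖ q ⊎-dec clear? P p q s

data Side : Set where
  leftmost rightmost highest : Side

sides : List Side
sides = leftmost ∷ rightmost ∷ highest ∷ []

-- Where the other points of the cell c can be once its extremal point has moved to
-- advance c c, the place with both coordinates of c increased by 1.
Beyond : Side → Rel Place 0ℓ
Beyond leftmost  (c₁ , _) (t₁ , _) = suc c₁ ≤ t₁
Beyond rightmost (c₁ , _) (t₁ , _) = t₁ ≤ suc c₁
Beyond highest   (_ , c₂) (_ , t₂) = t₂ ≤ suc c₂

beyond? : ∀ side → Decidable₂ (Beyond side)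
beyond? leftmost  (c₁ , _) (t₁ , _) = suc c₁ ≤? t₁
beyond? rightmost (c₁ , _) (t₁ , _) = t₁ ≤? suc c₁
beyond? highest   (_ , c₂) (_ , t₂) = t₂ ≤? suc c₂

-- The place of a known point, formerly s, after adding a point at c to the known ones.
advance : Place → Place → Place
advance (c₁ , c₂) (s₁ , s₂) = δ c₁ s₁ + s₁ , δ c₂ s₂ + s₂

-- allowed lists the places where points may be; base is the place of the first point of
-- the initial occurrence of (12 , R).
record State : Set where
  constructor state
  field
    allowed : List Place
    base    : Place
    points  : List Place

open State

-- A place in the row or column of `c` is split by the new point. Extremality restricts only the
-- place `c` itself.
refine : Side → Place → Place → List Place
refine side c@(c₁ , c₂) s@(s₁ , s₂) =
  filter (λ t → s ≟ᵖ c →-dec beyond? side c t)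
         (cartesianProduct (choices c₁ s₁) (choices c₂ s₂))

insert : Side → Place → State → State
insert side c (state ss b ps) =
  -- The new point's own place never arises from `choices`, so it is listed separately.
  state (advance c c ∷
         filter (λ s → ¬? (completes321? ps′ s)) (concatMap (refine side c) ss))
        (advance c b) ps′
  where ps′ = map (advance c) (c ∷ ps)

double : Fin 3 × Fin 3 → Place
double (i , j) = 2 * toℕ i , 2 * toℕ j

unshadedPlaces : Shading 2 → List Place
unshadedPlaces R = map double (filter (unshaded? R) (cartesianProduct (allFin 3) (allFin 3)))

start : Shading 2 → State
start R = state ((1 , 1) ∷ (3 , 3) ∷ unshadedPlaces R) (1 , 1) ((1 , 1) ∷ (3 , 3) ∷ [])

module Search (R S : Shading 2) where

  mutual

    -- A certificate that no configuration meeting the hypotheses is described by the state. The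
    -- number bounds the depth of the case distinction; at depth 0 nothing is refuted.
    Refutes : ℕ → State → Set
    Refutes zero    st = ⊥
    Refutes (suc k) st = Any (λ p → Any (Step k st p) (points st)) (points st)

    Step : ℕ → State → Place → Place → Set
    Step k st p q = Ascends p q ×
      -- An occurrence of `S` is contradictory anywhere, one of `R` only if it starts to the right
      -- of the base point.
      (Forms k S st p q ⊎ (proj₁ (base st) < proj₁ p × Forms k R st p q))

    Forms : ℕ → Shading 2 → State → Place → Place → Set
    Forms k P st p q = All (λ s → Harmless P p q s ⊎
      -- Adding a known point again would bring no new information.
      (s ∉ points st × Any (λ side → Refutes k (insert side s st)) sides)) (allowed st)

  mutual

    refutes? : ∀ k st → Dec (Refutes k st)
    refutes? zero    st = no λ ()
    refutes? (suc k) st = any? (λ p → any? (step? k st p) (points st)) (points st)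

    step? : ∀ k st p q → Dec (Step k st p q)
    step? k st p q = ascends? p q ×-dec
      (forms? k S st p q ⊎-dec (proj₁ (base st) <? proj₁ p ×-dec forms? k R st p q))

    forms? : ∀ k P st p q → Dec (Forms k P st p q)
    forms? k P st p q = All.all? (λ s → harmless? P p q s ⊎-dec
      (¬? (s ∈ˡ? points st) ×-dec any? (λ side → refutes? k (insert side s st)) sides)) (allowed st)

open Search

-- Soundness of the search

module _ {n : ℕ} (π : Permutation′ n) where

  value : Fin n → ℕ
  value x = toℕ (π ⟨$⟩ʳ x)

  ⟨$⟩ʳ-injective : ∀ {x y} → π ⟨$⟩ʳ x ≡ π ⟨$⟩ʳ y → x ≡ y
  ⟨$⟩ʳ-injective = Injection.injective (↔⇒↣ π)

  value-injective : ∀ {x y} → value x ≡ value y → x ≡ y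
  value-injective = ⟨$⟩ʳ-injective ∘ Fin.toℕ-injective

  plot : Fin n → Place
  plot x = toℕ x , value x

  Occurs12 : Shading 2 → Rel (Fin n) 0ℓ
  Occurs12 P a b = Ascends (plot a) (plot b) ×
    (∀ x → x ≢ a → x ≢ b → Clear P (plot a) (plot b) (plot x))

  Avoids12 : Pred (Shading 2) 0ℓ
  Avoids12 P = ∀ a b → ¬ Occurs12 P a b

  Avoids321 : Set
  Avoids321 = ∀ a b c → Descends (plot a) (plot b) → ¬ Descends (plot b) (plot c)

  -- Passing plot a and plot b as arguments makes Agda evaluate them only once.
  occurs12? : ∀ P a b → Dec (Occurs12 P a b)
  occurs12? P a b = occurs (plot a) (plot b)
    where
    occurs : ∀ p q → Dec (Ascends p q × (∀ x → x ≢ a → x ≢ b → Clear P p q (plot x)))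
    occurs p q = ascends? p q ×-dec
      Fin.all? λ x → ¬? (x Fin.≟ a) →-dec ¬? (x Fin.≟ b) →-dec clear? P p q (plot x)

  avoids12? : Decidable Avoids12
  avoids12? P = Fin.all? λ a → Fin.all? λ b → ¬? (occurs12? P a b)

  avoids321? : Dec Avoids321
  avoids321? = Fin.all? λ a → Fin.all? λ b → Fin.all? λ c →
    descends? (plot a) (plot b) →-dec ¬? (descends? (plot b) (plot c))

  Precedes : Side → Rel (Fin n) 0ℓ
  Precedes leftmost  = Fin._<_
  Precedes rightmost = Fin._>_
  Precedes highest   = Fin._>_ on (π ⟨$⟩ʳ_)

  precedes-wellFounded : ∀ side → WellFounded (Precedes side)
  precedes-wellFounded leftmost  = Fin.<-wellFounded
  precedes-wellFounded rightmost = Fin.>-wellFounded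
  precedes-wellFounded highest   = On.wellFounded (π ⟨$⟩ʳ_) Fin.>-wellFounded

  place : List (Fin n) → Fin n → Place
  place zs x = rank toℕ zs x , rank value zs x

  place-injective : ∀ {zs x z} → z ∈ˡ zs → place zs x ≡ place zs z → x ≡ z
  place-injective z∈ = Fin.toℕ-injective ∘ rank-injective toℕ z∈ ∘ cong proj₁

  ascends-plot : ∀ zs {a b} → Ascends (place zs a) (place zs b) → Ascends (plot a) (plot b)
  ascends-plot zs (a₁<b₁ , a₂<b₂) = rank-reflects-< toℕ zs a₁<b₁ , rank-reflects-< value zs a₂<b₂

  descends-plot : ∀ zs {a b} → Descends (place zs a) (place zs b) → Descends (plot a) (plot b)
  descends-plot zs (a₁<b₁ , b₂<a₂) = rank-reflects-< toℕ zs a₁<b₁ , rank-reflects-< value zs b₂<a₂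

  clear-plot : ∀ P {zs a b} x → a ∈ˡ zs → b ∈ˡ zs →
               Clear P (place zs a) (place zs b) (place zs x) → Clear P (plot a) (plot b) (plot x)
  clear-plot P x a∈ b∈ =
    subst (_∉ᵖ cells P) (cong₂ _,_ (zone-rank toℕ x a∈ b∈) (zone-rank value x a∈ b∈))

  harmless-plot : ∀ P {zs a b} x → a ∈ˡ zs → b ∈ˡ zs → x ≢ a → x ≢ b →
                  Harmless P (place zs a) (place zs b) (place zs x) →
                  Clear P (plot a) (plot b) (plot x)
  harmless-plot P x a∈ b∈ x≢a x≢b (inj₁ eq)           = contradiction (place-injective a∈ eq) x≢a
  harmless-plot P x a∈ b∈ x≢a x≢b (inj₂ (inj₁ eq))    = contradiction (place-injective b∈ eq) x≢b
  harmless-plot P x a∈ b∈ x≢a x≢b (inj₂ (inj₂ clear)) = clear-plot P x a∈ b∈ clear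

  -- As the old ranks agree, the summand `δ` against `z` decides; not preceding `z` makes it at
  -- least 1 or at most 1, according to the side.
  beyond : ∀ side zs {x z} → ¬ Precedes side x z → place zs x ≡ place zs z →
           Beyond side (place zs z) (place (z ∷ zs) x)
  beyond leftmost  zs {z = z} ⊀ eq rewrite cong proj₁ eq = +-monoˡ-≤ (rank toℕ zs z) (δ-≥ (≮⇒≥ ⊀))
  beyond rightmost zs {z = z} ⊀ eq rewrite cong proj₁ eq = +-monoˡ-≤ (rank toℕ zs z) (δ-≤ (≮⇒≥ ⊀))
  beyond highest   zs {z = z} ⊀ eq rewrite cong proj₂ eq = +-monoˡ-≤ (rank value zs z) (δ-≤ (≮⇒≥ ⊀))

  place-advance : ∀ zs z {x} → x ∈ˡ z ∷ zs → place (z ∷ zs) x ≡ advance (place zs z) (place zs x)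
  place-advance zs z {x} x∈ =
    cong₂ _,_ (cong (_+ rank toℕ zs x)   (sym (δ-rank-∈ toℕ zs z x∈)))
              (cong (_+ rank value zs x) (sym (δ-rank-∈ value zs z x∈)))

  -- `allowed` is an upper bound: it may list places where `π` has no point.
  record Describes (x₀ : Fin n) (zs : List (Fin n)) (st : State) : Set where
    field
      base∈    : x₀ ∈ˡ zs
      allowed∋ : ∀ x → place zs x ∈ˡ allowed st
      base≡    : base st ≡ place zs x₀
      points≡  : points st ≡ map (place zs) zs

  open Describes

  describes-start : ∀ R {a b} → Occurs12 R a b → Describes a (a ∷ b ∷ []) (start R)
  describes-start R {a} {b} ((a<b , πa<πb) , clear) = record
    { base∈    = here refl
    ; allowed∋ = allowed∋′
    ; base≡    = sym place-a
    ; points≡  = cong₂ (λ s t → s ∷ t ∷ []) (sym place-a) (sym place-b)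
    }
    where
    place-a = cong₂ _,_ (rank-first toℕ {a} {b} a<b) (rank-first value {a} {b} πa<πb)
    place-b = cong₂ _,_ (rank-second toℕ {a} {b} a<b) (rank-second value {a} {b} πa<πb)
    allowed∋′ : ∀ x → place (a ∷ b ∷ []) x ∈ˡ allowed (start R)
    allowed∋′ x with x Fin.≟ a | x Fin.≟ b
    ... | yes refl | _        = here place-a
    ... | no _     | yes refl = there (here place-b)
    ... | no x≢a   | no x≢b   = there (there (subst (_∈ˡ unshadedPlaces R)
      (sym (cong₂ _,_
        (rank-zone toℕ a<b (x≢a ∘ Fin.toℕ-injective) (x≢b ∘ Fin.toℕ-injective))
        (rank-zone value πa<πb (x≢a ∘ value-injective) (x≢b ∘ value-injective))))
      (∈-map⁺ double (∈-filter⁺ (unshaded? R)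
        (∈-cartesianProduct⁺ (∈-allFin _) (∈-allFin _)) (clear x x≢a x≢b)))))

  module _ (avoids321 : Avoids321) where

    ¬completes321 : ∀ zs x → ¬ Completes321 (map (place zs) zs) (place zs x)
    ¬completes321 zs x any with find any
    ... | p , p∈ , any′ with find any′
    ...   | q , q∈ , order with ∈-map⁻ (place zs) p∈ | ∈-map⁻ (place zs) q∈
    ...     | y , _ , refl | z , _ , refl =
      [ impossible x y z , [ impossible y x z , impossible y z x ]′ ]′ order
      where
      impossible : ∀ a b c → ¬ (Descends (place zs a) (place zs b) ×
                                Descends (place zs b) (place zs c))
      impossible a b c (ab , bc) = avoids321 a b c (descends-plot zs ab) (descends-plot zs bc)

    module _ {x₀ : Fin n} where

      -- Every point other than `z` moves to a place that survives both filters: the one in `refine`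
      -- by extremality of `z`, the other by avoidance of 321.
      describes-insert : ∀ side {zs z st} → Describes x₀ zs st →
        (∀ x → place zs x ≡ place zs z → ¬ Precedes side x z) →
        Describes x₀ (z ∷ zs) (insert side (place zs z) st)
      describes-insert side {zs} {z} {st} d extremal = record
        { base∈    = there (base∈ d)
        ; allowed∋ = allowed∋′
        ; base≡    = trans (cong (advance (place zs z)) (base≡ d))
                           (sym (place-advance zs z (there (base∈ d))))
        ; points≡  = points≡′
        }
        where
        points≡′ : map (advance (place zs z)) (place zs z ∷ points st) ≡
                   map (place (z ∷ zs)) (z ∷ zs)
        points≡′ = begin
          map (advance (place zs z)) (place zs z ∷ points st)
            ≡⟨ cong (map (advance (place zs z)) ∘ (place zs z ∷_)) (points≡ d) ⟩
          map (advance (place zs z)) (map (place zs) (z ∷ zs))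
            ≡⟨ map-∘ (z ∷ zs) ⟨
          map (advance (place zs z) ∘ place zs) (z ∷ zs)
            ≡⟨ map-cong-local (All.tabulate (place-advance zs z)) ⟨
          map (place (z ∷ zs)) (z ∷ zs) ∎
          where open ≡-Reasoning
        allowed∋′ : ∀ x → place (z ∷ zs) x ∈ˡ allowed (insert side (place zs z) st)
        allowed∋′ x with x Fin.≟ z
        ... | yes refl = here (place-advance zs z (here refl))
        ... | no x≢z   = there (∈-filter⁺ _
          (∈-concatMap⁺ (refine side (place zs z)) (lose (allowed∋ d x)
            (∈-filter⁺ _
              (∈-cartesianProduct⁺
                (rank∈choices toℕ zs z (x≢z ∘ Fin.toℕ-injective))
                (rank∈choices value zs z (x≢z ∘ value-injective)))
              λ eq → beyond side zs (extremal x eq) eq)))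
          (subst (λ ps → ¬ Completes321 ps (place (z ∷ zs) x)) (sym points≡′)
                 (¬completes321 (z ∷ zs) x)))

      module _ {R S : Shading 2} (avoidsS : Avoids12 S)
               (avoidsR : ∀ a b → x₀ Fin.< a → ¬ Occurs12 R a b) where

        mutual

          refute : ∀ k {zs st} → Describes x₀ zs st → ¬ Refutes R S k st
          refute (suc k) {zs} {st} d any =
            let a , a∈ , any′ = find (Any.map⁻
                  (subst (λ ps → Any (λ p → Any (Step R S k st p) ps) ps) (points≡ d) any))
                b , b∈ , step = find (Any.map⁻ any′)
            in refute-step k d a∈ b∈ step

          refute-step : ∀ k {zs st a b} → Describes x₀ zs st → a ∈ˡ zs → b ∈ˡ zs →
                        ¬ Step R S k st (place zs a) (place zs b)
          refute-step k {a = a} {b} d a∈ b∈ (ascends , inj₁ forms) =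
            avoidsS a b (forms⇒occurs k S d a∈ b∈ ascends forms)
          refute-step k {zs} {a = a} {b} d a∈ b∈ (ascends , inj₂ (base<a , forms)) =
            avoidsR a b
              (rank-reflects-< toℕ zs (subst (λ s → proj₁ s < rank toℕ zs a) (base≡ d) base<a))
              (forms⇒occurs k R d a∈ b∈ ascends forms)

          forms⇒occurs : ∀ k P {zs st a b} → Describes x₀ zs st → a ∈ˡ zs → b ∈ˡ zs →
                         Ascends (place zs a) (place zs b) →
                         Forms R S k P st (place zs a) (place zs b) → Occurs12 P a b
          forms⇒occurs k P {zs} d a∈ b∈ ascends forms = ascends-plot zs ascends ,
            λ x x≢a x≢b →
              [ harmless-plot P x a∈ b∈ x≢a x≢b
              , (λ (_ , some) → contradiction refl (place-excluded k d some x)) ]′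
              (All.lookup forms (allowed∋ d x))

          place-excluded : ∀ k {zs st s} → Describes x₀ zs st →
                           Any (λ side → Refutes R S k (insert side s st)) sides →
                           ∀ x → place zs x ≢ s
          place-excluded k d some x =
            let side , _ , refutes = find some
            in descend k d side refutes (precedes-wellFounded side x)

          -- Induction along `Precedes` replaces the choice of an extremal point: points preceding
          -- `x` are already known not to lie in the place `s`, so `x` would be extremal there and
          -- could be inserted.
          descend : ∀ k {zs st s} → Describes x₀ zs st →
                    ∀ side → Refutes R S k (insert side s st) →
                    ∀ {x} → Acc (Precedes side) x → place zs x ≢ s
          descend k d side refutes (acc rs) refl = refute k
            (describes-insert side d λ y eq y≺x → descend k d side refutes (rs y≺x) eq) refutes

-- Implications between shadings

infix 4 _⊢[_]_ _⊢?[_]_ _⊨_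

-- At most k ∸ 1 points are added to a given occurrence of (12 , R).
_⊢[_]_ : Shading 2 → ℕ → Shading 2 → Set
R ⊢[ k ] S = Refutes R S k (start R)

_⊢?[_]_ : ∀ R k S → Dec (R ⊢[ k ] S)
R ⊢?[ k ] S = refutes? R S k (start R)

-- Contrapositively, a 321-avoiding permutation that contains `(12 , R)` contains `(12 , S)`.
record _⊨_ (R S : Shading 2) : Set where
  field
    avoids : ∀ {n} (π : Permutation′ n) → Avoids321 π → Avoids12 π S → Avoids12 π R

open _⊨_

⊨-refl : ∀ {R} → R ⊨ R
⊨-refl .avoids π avoids321 avoidsR = avoidsR

⊨-trans : ∀ {R S T} → R ⊨ S → S ⊨ T → R ⊨ T
⊨-trans R⊨S S⊨T .avoids π avoids321 = R⊨S .avoids π avoids321 ∘ S⊨T .avoids π avoids321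

-- Induction on the first point `a` from right to left: occurrences of `R` that start further right
-- are excluded already, as the refutation demands.
⊢-sound : ∀ k R S → R ⊢[ k ] S → R ⊨ S
⊢-sound k R S R⊢S .avoids π avoids321 avoidsS a = go (Fin.>-wellFounded a)
  where
  go : ∀ {a} → Acc Fin._>_ a → ∀ b → ¬ Occurs12 π R a b
  go (acc rs) b occurs = refute π avoids321 avoidsS (λ a′ b′ a<a′ → go (rs a<a′) b′) k
    (describes-start π R occurs) R⊢S

-- Mesh pattern occurrences in coordinates

module _ {k n} {α : Fin k → Fin n} where

  increasing⁺ : (∀ {i j} → i Fin.< j → α i Fin.< α j) → OrderPreservingInjection α
  increasing⁺ increasing = monotone , injective
    where
    monotone : ∀ {i j} → i Fin.≤ j → α i Fin.≤ α j
    monotone {i} {j} i≤j with Fin.<-cmp i j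
    ... | tri< i<j _ _  = <⇒≤ (increasing i<j)
    ... | tri≈ _ refl _ = ≤-refl
    ... | tri> _ _ j<i  = contradiction i≤j (<⇒≱ j<i)
    injective : ∀ {i j} → α i ≡ α j → i ≡ j
    injective {i} {j} eq with Fin.<-cmp i j
    ... | tri< i<j _ _ = contradiction eq (Fin.<⇒≢ (increasing i<j))
    ... | tri≈ _ i≡j _ = i≡j
    ... | tri> _ _ j<i = contradiction (sym eq) (Fin.<⇒≢ (increasing j<i))

  increasing⁻ : OrderPreservingInjection α → ∀ {i j} → i Fin.< j → α i Fin.< α j
  increasing⁻ (monotone , injective) i<j =
    ≤∧≢⇒< (monotone (<⇒≤ i<j)) λ eq → Fin.<⇒≢ i<j (injective (Fin.toℕ-injective eq))

module _ {k n} (τ : Permutation′ k) (R : Shading k) (π : Permutation′ n) where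

  -- The set of points of an occurrence is determined by `α` and `β`; its inclusion in the plot
  -- becomes one equation per index of `τ`.
  Embeds : (α β : Fin k → Fin n) → Set
  Embeds α β = OrderPreservingInjection α × OrderPreservingInjection β ×
    (∀ i → π ⟨$⟩ʳ α i ≡ β (τ ⟨$⟩ʳ i)) × (∀ {c} → c ∈ cells R → Empty (Region α β c ∩ G π))

  occurrence⁺ : ∃₂ Embeds → ∃ (IsOccurrence (mesh τ R) π)
  occurrence⁺ (α , β , opi-α , opi-β , eq , empty) =
    Image α β (G τ) , (λ { (i , _ , refl , refl , refl) → eq i }) ,
    α , β , opi-α , opi-β , (id , id) , empty

  occurrence⁻ : ∃ (IsOccurrence (mesh τ R) π) → ∃₂ Embeds
  occurrence⁻ (ω , ω⊆G , α , β , opi-α , opi-β , (_ , image⊆ω) , empty) =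
    α , β , opi-α , opi-β , (λ i → ω⊆G (image⊆ω (i , _ , refl , refl , refl))) , empty

module _ {n} (α : Fin 2 → Fin n) (a<b : α 0F Fin.< α 1F) where

  between⇒zone : ∀ {i x} → Between α i x →
                 zone (toℕ (α 0F)) (toℕ (α 1F)) (toℕ x) ≡ i × x ≢ α 0F × x ≢ α 1F
  between⇒zone {0F} (_ , s≤s x<a) =
    zone-0 {q = toℕ (α 1F)} x<a , Fin.<⇒≢ x<a , Fin.<⇒≢ (<-trans x<a a<b)
  between⇒zone {1F} (s≤s a<x , s≤s x<b) =
    zone-1 a<x x<b , ≢-sym (Fin.<⇒≢ a<x) , Fin.<⇒≢ x<b
  between⇒zone {2F} (s≤s b<x , _) =
    zone-2 a<b b<x , ≢-sym (Fin.<⇒≢ (<-trans a<b b<x)) , ≢-sym (Fin.<⇒≢ b<x)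

  zone⇒between : ∀ {x} → x ≢ α 0F → x ≢ α 1F →
                 Between α (zone (toℕ (α 0F)) (toℕ (α 1F)) (toℕ x)) x
  zone⇒between {x} x≢a x≢b with zoneView (x≢a ∘ Fin.toℕ-injective) (x≢b ∘ Fin.toℕ-injective)
  -- The outermost bounds 0 and n + 1 hold for every point.
  ... | below x<a rewrite zone-0 {q = toℕ (α 1F)} x<a = s≤s z≤n , s≤s x<a
  ... | between a<x x<b rewrite zone-1 a<x x<b = s≤s a<x , s≤s x<b
  ... | above b<x rewrite zone-2 a<b b<x = s≤s b<x , s≤s (Fin.toℕ<n x)

module _ {n} {a b : Fin n} (a<b : a Fin.< b) where

  increasing₂ : OrderPreservingInjection (a ∷ᶠ b ∷ᶠ []ᶠ)
  increasing₂ = increasing⁺ λ { {0F} {1F} _ → a<b ; {1F} {1F} (s≤s ()) }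

  increasing₃ : ∀ {c} → b Fin.< c → OrderPreservingInjection (a ∷ᶠ b ∷ᶠ c ∷ᶠ []ᶠ)
  increasing₃ b<c = increasing⁺ λ
    { {0F} {1F} _ → a<b ; {0F} {2F} _ → <-trans a<b b<c ; {1F} {2F} _ → b<c
    ; {1F} {1F} (s≤s ()) ; {2F} {1F} (s≤s ()) ; {2F} {2F} (s≤s (s≤s ())) }

module _ {n} (π : Permutation′ n) where

  avoids12-⇔ : ∀ R → Avoids (n , π) (mesh p12 R) ⇔ Avoids12 π R
  avoids12-⇔ R = mk⇔
    (λ avoids a b ((a<b , πa<πb) , clear) →
      let α = a ∷ᶠ b ∷ᶠ []ᶠ
          β = (π ⟨$⟩ʳ a) ∷ᶠ (π ⟨$⟩ʳ b) ∷ᶠ []ᶠ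
      in avoids (occurrence⁺ p12 R π
        ( α , β , increasing₂ a<b , increasing₂ πa<πb , (λ { 0F → refl ; 1F → refl })
        , λ { {c} shaded (x , _) ((x∈ , y∈) , refl) →
              let zone-x , x≢a , x≢b = between⇒zone α a<b x∈
                  zone-y , _ = between⇒zone β πa<πb y∈
              in clear x x≢a x≢b
                   (subst (_∈ cells R) (sym (cong₂ _,_ zone-x zone-y)) shaded) } )))
    λ avoids12 occurrence →
      let α , β , opi-α , opi-β , eq , empty = occurrence⁻ p12 R π occurrence
          a<b   = increasing⁻ opi-α {0F} {1F} (s≤s z≤n)
          βa<βb = increasing⁻ opi-β {0F} {1F} (s≤s z≤n)
      in avoids12 (α 0F) (α 1F)
        ( (a<b , subst₂ Fin._<_ (sym (eq 0F)) (sym (eq 1F)) βa<βb)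
        , λ x x≢a x≢b shaded → empty
            -- Since 12 is the identity, `eq` says that `β` is `π` after `α`.
            (subst₂ (λ y z → (zone (toℕ (α 0F)) (toℕ (α 1F)) (toℕ x) ,
                              zone (toℕ y) (toℕ z) (value π x)) ∈ cells R)
                    (eq 0F) (eq 1F) shaded)
            (x , π ⟨$⟩ʳ x)
            ( ( zone⇒between α a<b x≢a x≢b
              , zone⇒between β βa<βb (λ e → x≢a (⟨$⟩ʳ-injective π (trans e (sym (eq 0F)))))
                                     (λ e → x≢b (⟨$⟩ʳ-injective π (trans e (sym (eq 1F))))) )
            , refl ) )

  avoids321-⇔ : Avoids (n , π) (classical p321) ⇔ Avoids321 π
  avoids321-⇔ = mk⇔
    (λ avoids a b c (a<b , πb<πa) (b<c , πc<πb) → avoids (occurrence⁺ p321 (replicate 4 _) π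
      -- Values run opposite to positions, so `β` lists them from `c` back to `a`.
      ( a ∷ᶠ b ∷ᶠ c ∷ᶠ []ᶠ , (π ⟨$⟩ʳ c) ∷ᶠ (π ⟨$⟩ʳ b) ∷ᶠ (π ⟨$⟩ʳ a) ∷ᶠ []ᶠ
      , increasing₃ a<b b<c , increasing₃ πc<πb πb<πa
      , (λ { 0F → refl ; 1F → refl ; 2F → refl })
      , λ { {i , j} shaded → contradiction (subst (j ∈ˢ_) (lookup-replicate i _) shaded) ∉⊥ } )))
    λ avoids321 occurrence →
      let α , β , opi-α , opi-β , eq , _ = occurrence⁻ p321 (replicate 4 _) π occurrence
      in avoids321 (α 0F) (α 1F) (α 2F)
        ( increasing⁻ opi-α {0F} {1F} (s≤s z≤n)
        , subst₂ Fin._<_ (sym (eq 1F)) (sym (eq 0F)) (increasing⁻ opi-β {1F} {2F} (s≤s (s≤s z≤n))) )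
        ( increasing⁻ opi-α {1F} {2F} (s≤s (s≤s z≤n))
        , subst₂ Fin._<_ (sym (eq 2F)) (sym (eq 1F)) (increasing⁻ opi-β {0F} {1F} (s≤s z≤n)) )

-- Coincidence as implication in both directions

Av321And : Shading 2 → Pred Perm (lsuc 0ℓ)
Av321And R = Av (｛ classical p321 ｝ ∪ ｛ mesh p12 R ｝)

av321And-⇔ : ∀ R {n} (π : Permutation′ n) → (n , π) ∈ Av321And R ⇔ (Avoids321 π × Avoids12 π R)
av321And-⇔ R π = mk⇔
  (λ av → to (avoids321-⇔ π) (av (inj₁ refl)) , to (avoids12-⇔ π R) (av (inj₂ refl)))
  λ { (avoids321 , _) (inj₁ refl) → from (avoids321-⇔ π) avoids321
    ; (_ , avoids12)  (inj₂ refl) → from (avoids12-⇔ π R) avoids12 }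
  where open Equivalence

⊆⇒⊨ : ∀ R S → Av321And R ⊆ Av321And S → S ⊨ R
⊆⇒⊨ R S R⊆S .avoids π avoids321 avoidsR =
  proj₂ (to (av321And-⇔ S π) (R⊆S {_ , π} (from (av321And-⇔ R π) (avoids321 , avoidsR))))
  where open Equivalence

⊨⇒⊆ : ∀ R S → S ⊨ R → Av321And R ⊆ Av321And S
⊨⇒⊆ R S S⊨R {_ , π} av =
  let avoids321 , avoidsR = to (av321And-⇔ R π) av
  in from (av321And-⇔ S π) (avoids321 , S⊨R .avoids π avoids321 avoidsR)
  where open Equivalence

≐⇒⊨ : ∀ R S → Av321And R ≐ Av321And S → R ⊨ S × S ⊨ R
≐⇒⊨ R S (R⊆S , S⊆R) = ⊆⇒⊨ S R (λ {σ} → S⊆R {σ}) , ⊆⇒⊨ R S (λ {σ} → R⊆S {σ})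

-- Separating the classes

-- The digit at i counts the later, smaller entries of the permutation.
fromLehmer : (code : List ℕ) → Permutation′ (length code)
fromLehmer []         = Perm.id
fromLehmer (c ∷ code) = Perm.insert zero (c mod suc (length code)) (fromLehmer code)

signature : List (List ℕ) → Shading 2 → List Bool
signature codes R = map (λ code → does (avoids12? (fromLehmer code) R)) codes

signature-cong : ∀ {codes} → All (Avoids321 ∘ fromLehmer) codes → ∀ {R S} →
                 R ⊨ S → S ⊨ R → signature codes R ≡ signature codes S
signature-cong avoid321 {R} {S} R⊨S S⊨R = map-cong-local (All.map
  (λ {code} avoids321 → let π = fromLehmer code in
    does-⇔ (mk⇔ (S⊨R .avoids π avoids321) (R⊨S .avoids π avoids321)) (avoids12? π R) (avoids12? π S))
  avoid321)

-- Eighteen 321-avoiding permutations of lengths 3 to 5. Shadings from different classes are told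
-- apart by which of these avoid the pattern.
tests : List (List ℕ)
tests =
  (0 ∷ 1 ∷ 0 ∷ []) ∷
  (1 ∷ 0 ∷ 0 ∷ []) ∷
  (1 ∷ 1 ∷ 0 ∷ []) ∷
  (2 ∷ 0 ∷ 0 ∷ []) ∷
  (0 ∷ 1 ∷ 0 ∷ 0 ∷ []) ∷
  (0 ∷ 1 ∷ 1 ∷ 0 ∷ []) ∷
  (1 ∷ 0 ∷ 0 ∷ 0 ∷ []) ∷
  (0 ∷ 0 ∷ 2 ∷ 0 ∷ 0 ∷ []) ∷
  (0 ∷ 3 ∷ 0 ∷ 0 ∷ 0 ∷ []) ∷
  (1 ∷ 1 ∷ 1 ∷ 0 ∷ 0 ∷ []) ∷
  (1 ∷ 1 ∷ 2 ∷ 0 ∷ 0 ∷ []) ∷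
  (1 ∷ 2 ∷ 0 ∷ 1 ∷ 0 ∷ []) ∷
  (1 ∷ 3 ∷ 0 ∷ 0 ∷ 0 ∷ []) ∷
  (2 ∷ 0 ∷ 0 ∷ 1 ∷ 0 ∷ []) ∷
  (2 ∷ 0 ∷ 1 ∷ 1 ∷ 0 ∷ []) ∷
  (2 ∷ 0 ∷ 2 ∷ 0 ∷ 0 ∷ []) ∷
  (3 ∷ 0 ∷ 0 ∷ 0 ∷ 0 ∷ []) ∷
  (3 ∷ 0 ∷ 0 ∷ 1 ∷ 0 ∷ []) ∷ []

tests-avoid321 : All (Avoids321 ∘ fromLehmer) tests
tests-avoid321 = toWitness {a? = All.all? (λ code → avoids321? (fromLehmer code)) tests} _

-- Coincidences within a class

-- The bound 4 leaves room for three added points.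
Path : Shading 2 → List (Shading 2) → Shading 2 → Set
Path R []       T = R ⊢[ 4 ] T
Path R (S ∷ Ss) T = R ⊢[ 4 ] S × Path S Ss T

path? : ∀ R Ss T → Dec (Path R Ss T)
path? R []       T = R ⊢?[ 4 ] T
path? R (S ∷ Ss) T = R ⊢?[ 4 ] S ×-dec path? S Ss T

path-sound : ∀ R Ss T → Path R Ss T → ∀ {S} → S ∈ˡ R ∷ Ss → R ⊨ S × S ⊨ T
path-sound R []       T path          (here refl) = ⊨-refl , ⊢-sound 4 R T path
path-sound R (S ∷ Ss) T (step , path) (here refl) =
  ⊨-refl , ⊨-trans (⊢-sound 4 R S step) (proj₂ (path-sound S Ss T path (here refl)))
path-sound R (S ∷ Ss) T (step , path) (there U∈)  =
  let S⊨U , U⊨T = path-sound S Ss T path U∈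
  in ⊨-trans (⊢-sound 4 R S step) S⊨U , U⊨T

-- Going round the cycle, each member implies every other, at the cost of one search per member
-- instead of one per pair.
Cycle : Pred (List⁺ (Shading 2)) 0ℓ
Cycle (R ∷ Rs) = Path R Rs R

cycle? : Decidable Cycle
cycle? (R ∷ Rs) = path? R Rs R

-- Without added points, R ⊢[ 1 ] S holds as soon as S is contained in R.
Fits : Shading 2 → List⁺ (Shading 2) → Set
Fits R Ss = Any (λ S → R ⊢[ 1 ] S) (toList Ss) × Any (λ S → S ⊢[ 1 ] R) (toList Ss)

fits? : ∀ R Ss → Dec (Fits R Ss)
fits? R Ss = any? (λ S → R ⊢?[ 1 ] S) (toList Ss) ×-dec any? (λ S → S ⊢?[ 1 ] R) (toList Ss)

-- The chain runs from `R` to a member `S` contained in it, round the cycle through its head to a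
-- member `T` containing `R′`, and on to `R′`.
fits-sound : ∀ R R′ C → Cycle C → Fits R C → Fits R′ C → R ⊨ R′
fits-sound R R′ (H ∷ Hs) cycle (R⊢ , _) (_ , ⊢R′) =
  let S , S∈ , R⊢S  = find R⊢
      T , T∈ , T⊢R′ = find ⊢R′
  in ⊨-trans (⊢-sound 1 R S R⊢S)
    (⊨-trans (proj₂ (path-sound H Hs H cycle S∈))
    (⊨-trans (proj₁ (path-sound H Hs H cycle T∈)) (⊢-sound 1 T R′ T⊢R′)))

-- The cell (i , j) is shaded iff the binary digit of weight 2 ^ (3 i + j) is 1.
shading : ℕ → Shading 2
shading m = tabulate λ i → tabulate λ j → digit (3 * toℕ i + toℕ j)
  where
  digit : ℕ → Bool
  digit k = does (_/_ m (2 ^ k) ⦃ m^n≢0 2 k ⦄ % 2 ≟ 1)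

-- The minimal and maximal shadings of each class, in an order in which the search can
-- pass from each to the next and from the last to the first.
classes : Vec (List⁺ (Shading 2)) 213
classes = Vec.map (List⁺.map shading) (
  (0 ∷ 312 ∷ 306 ∷ 291 ∷ 297 ∷ 393 ∷ 408 ∷ 402 ∷ 387 ∷ 147 ∷ 51 ∷ 57 ∷ 153 ∷ []) ∷
  (4 ∷ 316 ∷ 310 ∷ 301 ∷ 295 ∷ 391 ∷ 151 ∷ 55 ∷ []) ∷ (10 ∷ 26 ∷ []) ∷ (11 ∷ 27 ∷ []) ∷
  (14 ∷ 62 ∷ []) ∷ (15 ∷ 63 ∷ []) ∷ (29 ∷ 61 ∷ []) ∷ (42 ∷ 58 ∷ []) ∷ (43 ∷ 59 ∷ []) ∷
  (64 ∷ 472 ∷ 466 ∷ 451 ∷ 457 ∷ 361 ∷ 121 ∷ 217 ∷ []) ∷ (68 ∷ 84 ∷ 325 ∷ []) ∷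
  (70 ∷ 214 ∷ 455 ∷ 196 ∷ []) ∷ (74 ∷ 218 ∷ []) ∷ (75 ∷ 219 ∷ []) ∷
  (76 ∷ 124 ∷ 365 ∷ 100 ∷ []) ∷ (78 ∷ 126 ∷ 366 ∷ 462 ∷ 222 ∷ []) ∷
  (79 ∷ 127 ∷ 367 ∷ 463 ∷ 223 ∷ []) ∷ (83 ∷ 211 ∷ []) ∷ [ 85 ] ∷ (87 ∷ 215 ∷ []) ∷
  (93 ∷ 125 ∷ []) ∷ [ 98 ] ∷ [ 99 ] ∷ (102 ∷ 359 ∷ []) ∷ (106 ∷ 122 ∷ []) ∷ (107 ∷ 123 ∷ []) ∷
  [ 114 ] ∷ [ 115 ] ∷ [ 117 ] ∷ (118 ∷ 220 ∷ []) ∷ [ 119 ] ∷ (138 ∷ 154 ∷ []) ∷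
  (139 ∷ 155 ∷ []) ∷ [ 140 ] ∷ [ 141 ] ∷ (142 ∷ 158 ∷ []) ∷ (143 ∷ 159 ∷ []) ∷ [ 156 ] ∷
  [ 157 ] ∷ (160 ∷ 176 ∷ []) ∷ [ 161 ] ∷ (162 ∷ 178 ∷ []) ∷ [ 163 ] ∷ (164 ∷ 182 ∷ []) ∷
  (165 ∷ 167 ∷ []) ∷ (168 ∷ 184 ∷ []) ∷ [ 169 ] ∷ [ 170 ] ∷ [ 171 ] ∷ (172 ∷ 188 ∷ []) ∷
  [ 173 ] ∷ [ 174 ] ∷ [ 175 ] ∷ [ 177 ] ∷ [ 179 ] ∷ (181 ∷ 183 ∷ []) ∷ [ 185 ] ∷ [ 186 ] ∷
  [ 187 ] ∷ [ 189 ] ∷ [ 190 ] ∷ [ 191 ] ∷ (204 ∷ 461 ∷ []) ∷ [ 213 ] ∷ [ 221 ] ∷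
  (224 ∷ 248 ∷ []) ∷ (225 ∷ 233 ∷ []) ∷ (226 ∷ 242 ∷ []) ∷ [ 227 ] ∷
  (228 ∷ 246 ∷ 252 ∷ 231 ∷ 237 ∷ []) ∷ [ 234 ] ∷ [ 235 ] ∷ [ 238 ] ∷ [ 239 ] ∷
  (241 ∷ 249 ∷ []) ∷ [ 243 ] ∷ [ 245 ] ∷ [ 247 ] ∷ [ 250 ] ∷ [ 251 ] ∷ [ 253 ] ∷ [ 254 ] ∷
  [ 255 ] ∷ [ 266 ] ∷ [ 267 ] ∷ (270 ∷ 302 ∷ []) ∷ (271 ∷ 303 ∷ []) ∷ [ 273 ] ∷ [ 275 ] ∷
  [ 277 ] ∷ [ 279 ] ∷ [ 281 ] ∷ [ 282 ] ∷ [ 283 ] ∷ [ 285 ] ∷ (286 ∷ 318 ∷ []) ∷ [ 287 ] ∷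
  [ 298 ] ∷ [ 299 ] ∷ [ 305 ] ∷ [ 307 ] ∷ [ 309 ] ∷ [ 311 ] ∷ [ 313 ] ∷ [ 314 ] ∷ [ 315 ] ∷
  [ 317 ] ∷ [ 319 ] ∷ (330 ∷ 458 ∷ []) ∷ (331 ∷ 459 ∷ []) ∷ [ 337 ] ∷ [ 339 ] ∷ [ 340 ] ∷
  [ 341 ] ∷ [ 342 ] ∷ [ 343 ] ∷ [ 345 ] ∷ (346 ∷ 474 ∷ []) ∷ [ 347 ] ∷ [ 348 ] ∷ [ 349 ] ∷
  [ 350 ] ∷ [ 351 ] ∷ [ 354 ] ∷ [ 355 ] ∷ [ 362 ] ∷ [ 363 ] ∷ (368 ∷ 376 ∷ []) ∷ [ 369 ] ∷
  [ 370 ] ∷ [ 371 ] ∷ (372 ∷ 380 ∷ []) ∷ [ 373 ] ∷ [ 374 ] ∷ [ 375 ] ∷ [ 377 ] ∷ [ 378 ] ∷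
  [ 379 ] ∷ [ 381 ] ∷ [ 382 ] ∷ [ 383 ] ∷ [ 394 ] ∷ [ 395 ] ∷ [ 396 ] ∷ [ 397 ] ∷ [ 398 ] ∷
  [ 399 ] ∷ [ 401 ] ∷ [ 403 ] ∷ (404 ∷ 406 ∷ []) ∷ [ 405 ] ∷ [ 407 ] ∷ [ 409 ] ∷ [ 410 ] ∷
  [ 411 ] ∷ [ 412 ] ∷ [ 413 ] ∷ [ 414 ] ∷ [ 415 ] ∷ (416 ∷ 432 ∷ []) ∷ [ 417 ] ∷
  (418 ∷ 434 ∷ []) ∷ [ 419 ] ∷ (420 ∷ 438 ∷ []) ∷ (421 ∷ 423 ∷ []) ∷ (424 ∷ 440 ∷ []) ∷
  [ 425 ] ∷ [ 426 ] ∷ [ 427 ] ∷ (428 ∷ 444 ∷ []) ∷ [ 429 ] ∷ [ 430 ] ∷ [ 431 ] ∷ [ 433 ] ∷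
  [ 435 ] ∷ [ 437 ] ∷ [ 439 ] ∷ [ 441 ] ∷ [ 442 ] ∷ [ 443 ] ∷ [ 445 ] ∷ [ 446 ] ∷ [ 447 ] ∷
  [ 465 ] ∷ [ 467 ] ∷ (468 ∷ 470 ∷ []) ∷ [ 469 ] ∷ [ 471 ] ∷ [ 473 ] ∷ [ 475 ] ∷ [ 476 ] ∷
  [ 477 ] ∷ [ 478 ] ∷ [ 479 ] ∷ (480 ∷ 504 ∷ []) ∷ (481 ∷ 489 ∷ []) ∷ (482 ∷ 498 ∷ []) ∷
  [ 483 ] ∷ (484 ∷ 487 ∷ 502 ∷ 508 ∷ 493 ∷ []) ∷ [ 490 ] ∷ [ 491 ] ∷ [ 494 ] ∷ [ 495 ] ∷
  [ 497 ] ∷ [ 499 ] ∷ [ 501 ] ∷ [ 503 ] ∷ [ 505 ] ∷ [ 506 ] ∷ [ 507 ] ∷ [ 509 ] ∷ [ 510 ] ∷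
  [ 511 ] ∷ [])

classes-cycle : ∀ i → Cycle (lookup classes i)
classes-cycle = toWitness {a? = Fin.all? λ i → cycle? (lookup classes i)} _

-- Classification of the 512 shadings

-- The last position stands for a missing entry.
index : ∀ {n} → List Bool → Vec (List Bool) (suc n) → Fin (suc n)
index x (y ∷ [])         = zero
index x (y ∷ ys@(_ ∷ _)) = if does (≡-dec Bool._≟_ x y) then zero else suc (index x ys)

classIn : ∀ {n} → List (List ℕ) → Vec (List Bool) (suc n) → Shading 2 → Fin (suc n)
classIn codes table R = index (signature codes R) table

classIn-cong : ∀ codes {n} (table : Vec (List Bool) (suc n)) →
               All (Avoids321 ∘ fromLehmer) codes → ∀ R S → R ⊨ S → S ⊨ R →
               classIn codes table R ≡ classIn codes table S
classIn-cong codes table avoid321 R S R⊨S S⊨R =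
  cong (λ s → index s table) (signature-cong avoid321 R⊨S S⊨R)

signatures : Vec (List Bool) 213
signatures = Vec.map (signature tests ∘ head) classes

-- Shadings with the same image fit the same cycle and hence coincide, which gives injectivity; the
-- heads serve as preimages for surjectivity.
bijection : ∀ {n} (Cs : Vec (List⁺ (Shading 2)) n) (f : Shading 2 → Fin n) →
            (∀ R S → R ⊨ S → S ⊨ R → f R ≡ f S) → (∀ i → f (head (lookup Cs i)) ≡ i) →
            (∀ i → Cycle (lookup Cs i)) → (∀ R → Fits R (lookup Cs (f R))) →
            Bijection coincidenceUnder321 (setoid (Fin n))
bijection Cs f f-cong f-head cycle fits = record
  { to        = f
  ; cong      = λ {R} {S} R≐S → uncurry (f-cong R S) (≐⇒⊨ R S R≐S)
  ; bijective =
      (λ {R} {S} eq → (λ {σ} → ⊨⇒⊆ R S (f-injective S R (sym eq)) {σ}) ,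
                      (λ {σ} → ⊨⇒⊆ S R (f-injective R S eq) {σ}))
    , λ i → let H = head (lookup Cs i) in
        H , λ {R} R≐H → trans (uncurry (f-cong R H) (≐⇒⊨ R H R≐H)) (f-head i)
  }
  where
  f-injective : ∀ R S → f R ≡ f S → R ⊨ S
  f-injective R S eq = fits-sound R S (lookup Cs (f S)) (cycle (f S))
    (subst (λ i → Fits R (lookup Cs i)) eq (fits R)) (fits S)

-- A shading is a vector of vectors of Booleans, so closure under vectors makes a statement about
-- all 512 of them decidable.
Exhaustible : Set → Set₁
Exhaustible A = ∀ {P : Pred A 0ℓ} → Decidable P → Dec (∀ x → P x)

exhaust-Bool : Exhaustible Bool
exhaust-Bool P? = map′ (λ { (t , f) true → t ; (t , f) false → f }) (λ p → p true , p false)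
                       (P? true ×-dec P? false)

exhaust-Vec : ∀ {A} → Exhaustible A → ∀ n → Exhaustible (Vec A n)
exhaust-Vec exhaust zero    P? = map′ (λ { p [] → p }) (λ p → p []) (P? [])
exhaust-Vec exhaust (suc n) P? = map′ (λ { p (x ∷ xs) → p x xs }) (λ p x xs → p (x ∷ xs))
  (exhaust λ x → exhaust-Vec exhaust n λ xs → P? (x ∷ xs))

-- In the two finite checks below, the table of signatures is an argument so that it is
-- evaluated only once.

class-head : ∀ i → classIn tests signatures (head (lookup classes i)) ≡ i
class-head = toWitness {a? = check signatures} _
  where
  check : ∀ table → Dec (∀ i → classIn tests table (head (lookup classes i)) ≡ i)
  check table = Fin.all? λ i → classIn tests table (head (lookup classes i)) Fin.≟ i

class-fits : ∀ R → Fits R (lookup classes (classIn tests signatures R))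
class-fits = toWitness {a? = check signatures} _
  where
  check : ∀ table → Dec (∀ R → Fits R (lookup classes (classIn tests table R)))
  check table = exhaust-Vec (exhaust-Vec exhaust-Bool 3) 3 λ R →
    fits? R (lookup classes (classIn tests table R))

mainTheorem7 : Bijection coincidenceUnder321 (setoid (Fin 213))
mainTheorem7 = bijection classes (classIn tests signatures)
  (classIn-cong tests signatures tests-avoid321) class-head classes-cycle class-fits
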